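{- Let $\mathcal{C}$ be a class of $\lambda$-models having both the finite intersection property and the ultraproduct property. Then $\mathcal{C}$ has a minimal model, i.e. there exists $\mathbf{A}\in\mathcal{C}$ such that $\mathrm{Eq}(\mathbf{A})\subseteq \mathrm{Eq}(\mathbf{B})$ for every $\mathbf{B}\in\mathcal{C}$.
   Context: A combinatory algebra is a structure $\mathbf{A}=(A,\cdot,\mathbf{k},\mathbf{s})$ with a binary operation $\cdot$ (application, associating to the left) and distinguished elements (basic combinators) $\mathbf{k},\mathbf{s}$ satisfying $\mathbf{k}xy=x$ and $\mathbf{s}xyz=xz(yz)$. A $\lambda$-model is a combinatory algebra in which any two closed combinatory terms whose standard translations into $\lambda$-terms are $\beta$-convertible have the same value, and which satisfies the Meyer–Scott axiom: for all $a,b$, if $ax=bx$ for all $x$, then $\mathbf{1}a=\mathbf{1}b$, where $\mathbf{1}=\mathbf{s}(\mathbf{k}\mathbf{i})$ and $\mathbf{i}=\mathbf{s}\mathbf{k}\mathbf{k}$. (This is the usual notion, axiomatized over combinatory algebras by finitely many first-order sentences.) Closed $\lambda$-terms are interpreted in a $\lambda$-model via their standard translation into closed combinatory terms. $\mathrm{Eq}(\mathbf{A})$ denotes the equational theory of $\mathbf{A}$: the set of equations $M=N$ between closed $\lambda$-terms (equivalently, closed combinatory terms) such that $M$ and $N$ have the same interpretation in $\mathbf{A}$. For a non-empty set $I$, a family $\{\mathbf{A}_i\}_{i\in I}$ of $\lambda$-models and a proper ultrafilter $U$ of $\mathcal{P}(I)$, the ultraproduct $(\prod_{i\in I}\mathbf{A}_i)/U$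 is the quotient of the product combinatory algebra by the congruence $a\sim_U b \iff \{i\in I : a(i)=b(i)\}\in U$; it is again a $\lambda$-model. An embedding is an injective map preserving application and the basic combinators $\mathbf{k},\mathbf{s}$. A class $\mathcal{C}$ of $\lambda$-models has the finite intersection property if for all $\mathbf{A},\mathbf{B}\in\mathcal{C}$ there exists $\mathbf{C}\in\mathcal{C}$ with $\mathrm{Eq}(\mathbf{C})\subseteq\mathrm{Eq}(\mathbf{A})\cap\mathrm{Eq}(\mathbf{B})$. It has the ultraproduct property if for every non-empty family $\{\mathbf{A}_i\}_{i\in I}$ of members of $\mathcal{C}$ and every proper ultrafilter $U$ of $\mathcal{P}(I)$, the ultraproduct $(\prod_{i\in I}\mathbf{A}_i)/U$ can be embedded into a member of $\mathcal{C}$. -}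

module Defs where

open import Level using (Level; 0ℓ; _⊔_) renaming (suc to lsuc)
open import Algebra.Bundles using (Magma; RawMagma)
open import Algebra.Structures using (IsMagma)
open import Algebra.Morphism.Structures using (module MagmaMorphisms)
open import Data.Fin.Base using (Fin; zero; suc)
open import Data.Maybe.Base using (Maybe; just; nothing; zipWith)
open import Data.Nat.Base using (ℕ; suc)
open import Data.Product.Base using (_×_; _,_; ∃; Σ-syntax)
open import Data.Sum.Base using (_⊎_)
open import Function.Base using (_∘_)
open import Relation.Binary.Core using (Rel)
open import Relation.Binary.Construct.Closure.Equivalence using (EqClosure)
open import Relation.Unary using (Pred; _∈_; _∉_; _⊆_; _∩_; ∁; ∅; U)

private
  variable
    n m : ℕ

-- Λ n and CL n: terms with free variables in Fin n (de Bruijn indices).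
infixl 7 _·_

data Λ (n : ℕ) : Set where
  var : Fin n → Λ n
  _·_ : Λ n → Λ n → Λ n
  ƛ   : Λ (suc n) → Λ n

Λ⁰ : Set
Λ⁰ = Λ 0

ext : (Fin n → Fin m) → Fin (suc n) → Fin (suc m)
ext ρ zero    = zero
ext ρ (suc i) = suc (ρ i)

rename : (Fin n → Fin m) → Λ n → Λ m
rename ρ (var i) = var (ρ i)
rename ρ (M · N) = rename ρ M · rename ρ N
rename ρ (ƛ M)   = ƛ (rename (ext ρ) M)

exts : (Fin n → Λ m) → Fin (suc n) → Λ (suc m)
exts σ zero    = var zero
exts σ (suc i) = rename suc (σ i)

subst : (Fin n → Λ m) → Λ n → Λ m
subst σ (var i) = σ i
subst σ (M · N) = subst σ M · subst σ N
subst σ (ƛ M)   = ƛ (subst (exts σ) M)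

_[_] : Λ (suc n) → Λ n → Λ n
M [ N ] = subst (λ { zero → N ; (suc i) → var i }) M

infix 4 _⟶β_ _=β_

data _⟶β_ {n : ℕ} : Rel (Λ n) 0ℓ where
  β  : ∀ {M N} → ƛ M · N ⟶β M [ N ]
  ξˡ : ∀ {M M′ N} → M ⟶β M′ → M · N ⟶β M′ · N
  ξʳ : ∀ {M N N′} → N ⟶β N′ → M · N ⟶β M · N′
  ξƛ : ∀ {M M′} → M ⟶β M′ → ƛ M ⟶β ƛ M′

_=β_ : Rel (Λ n) 0ℓ
_=β_ = EqClosure _⟶β_

data CL (n : ℕ) : Set where
  var : Fin n → CL n
  𝐤 𝐬 : CL n
  _·_ : CL n → CL n → CL n

toΛ : CL n → Λ n
toΛ (var i) = var i
toΛ 𝐤       = ƛ (ƛ (var (suc zero)))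
toΛ 𝐬       = ƛ (ƛ (ƛ (var (suc (suc zero)) · var zero · (var (suc zero) · var zero))))
toΛ (P · Q) = toΛ P · toΛ Q

-- nothing exactly when variable zero occurs in the term.
strengthen : CL (suc n) → Maybe (CL n)
strengthen (var zero)    = nothing
strengthen (var (suc i)) = just (var i)
strengthen 𝐤             = just 𝐤
strengthen 𝐬             = just 𝐬
strengthen (P · Q)       = zipWith _·_ (strengthen P) (strengthen Q)

-- Bracket abstraction of variable zero:
--   λ*x.x = skk,  λ*x.P = kP (x not in P),  λ*x.PQ = s(λ*x.P)(λ*x.Q) otherwise.
λ* : CL (suc n) → CL n
λ* (var zero)    = 𝐬 · 𝐤 · 𝐤
λ* (var (suc i)) = 𝐤 · var i
λ* 𝐤             = 𝐤 · 𝐤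
λ* 𝐬             = 𝐤 · 𝐬
λ* (P · Q) with strengthen (P · Q)
... | just R  = 𝐤 · R
... | nothing = 𝐬 · λ* P · λ* Q

toCL : Λ n → CL n
toCL (var i) = var i
toCL (M · N) = toCL M · toCL N
toCL (ƛ M)   = λ* (toCL M)

-- Equality is a setoid equality, so that a quotient is formed by coarsening _≈_
-- without changing the carrier.
record CombinatoryAlgebra (ℓ : Level) : Set (lsuc ℓ) where
  infixl 7 _∙_
  infix  4 _≈_
  field
    Carrier : Set ℓ
    _≈_     : Rel Carrier ℓ
    _∙_     : Carrier → Carrier → Carrier
    k s     : Carrier
    isMagma : IsMagma _≈_ _∙_
    k-law   : ∀ x y → k ∙ x ∙ y ≈ x
    s-law   : ∀ x y z → s ∙ x ∙ y ∙ z ≈ x ∙ z ∙ (y ∙ z)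

  open IsMagma isMagma public using (refl; sym; trans; ∙-cong)

  magma : Magma ℓ ℓ
  magma = record { isMagma = isMagma }

  rawMagma : RawMagma ℓ ℓ
  rawMagma = Magma.rawMagma magma

  i 𝟏 : Carrier
  i = s ∙ k ∙ k
  𝟏 = s ∙ (k ∙ i)

  value : CL 0 → Carrier
  value (var ())
  value 𝐤       = k
  value 𝐬       = s
  value (P · Q) = value P ∙ value Q

record IsLambdaModel {ℓ} (A : CombinatoryAlgebra ℓ) : Set ℓ where
  open CombinatoryAlgebra A
  field
    β-sound     : ∀ (P Q : CL 0) → toΛ P =β toΛ Q → value P ≈ value Q
    meyer-scott : ∀ a b → (∀ x → a ∙ x ≈ b ∙ x) → 𝟏 ∙ a ≈ 𝟏 ∙ b

record LambdaModel (ℓ : Level) : Set (lsuc ℓ) where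
  field
    algebra       : CombinatoryAlgebra ℓ
    isLambdaModel : IsLambdaModel algebra

  open CombinatoryAlgebra algebra public
  open IsLambdaModel isLambdaModel public

  ⟦_⟧ : Λ⁰ → Carrier
  ⟦ M ⟧ = value (toCL M)

Eq : ∀ {ℓ} → LambdaModel ℓ → Pred (Λ⁰ × Λ⁰) ℓ
Eq A (M , N) = ⟦ M ⟧ ≈ ⟦ N ⟧
  where open LambdaModel A

record IsEmbedding {ℓ} (A B : CombinatoryAlgebra ℓ)
                   (f : CombinatoryAlgebra.Carrier A → CombinatoryAlgebra.Carrier B)
                   : Set ℓ where
  private
    module A = CombinatoryAlgebra A
    module B = CombinatoryAlgebra B
  open MagmaMorphisms A.rawMagma B.rawMagma
  field
    isMagmaMonomorphism : IsMagmaMonomorphism f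
    k-homo              : f A.k B.≈ B.k
    s-homo              : f A.s B.≈ B.s

  open IsMagmaMonomorphism isMagmaMonomorphism public

infix 4 _↪_

_↪_ : ∀ {ℓ} → CombinatoryAlgebra ℓ → CombinatoryAlgebra ℓ → Set ℓ
A ↪ B = ∃ (IsEmbedding A B)

-- `whole` and `proper` say I ∈ 𝓤 and ∅ ∉ 𝓤; the library's U and ∅ are
-- predicates of level 0ℓ, so the versions of them at level ℓ are described
-- by inclusions.
record IsProperUltrafilter {ℓ} {I : Set ℓ} (𝓤 : Pred (Pred I ℓ) ℓ) : Set (lsuc ℓ) where
  field
    upward : ∀ {S T : Pred I ℓ} → S ⊆ T → S ∈ 𝓤 → T ∈ 𝓤
    whole  : ∀ {S : Pred I ℓ} → U ⊆ S → S ∈ 𝓤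
    meet   : ∀ {S T : Pred I ℓ} → S ∈ 𝓤 → T ∈ 𝓤 → (S ∩ T) ∈ 𝓤
    proper : ∀ {S : Pred I ℓ} → S ⊆ ∅ → S ∉ 𝓤
    ultra  : ∀ (S : Pred I ℓ) → S ∈ 𝓤 ⊎ ∁ S ∈ 𝓤

module _ {ℓ} {I : Set ℓ} (A : I → CombinatoryAlgebra ℓ)
         (𝓤 : Pred (Pred I ℓ) ℓ) (isUltra : IsProperUltrafilter 𝓤) where
  private module A j = CombinatoryAlgebra (A j)
  open IsProperUltrafilter isUltra

  Ultraproduct : CombinatoryAlgebra ℓ
  Ultraproduct = record
    { Carrier = ∀ j → A.Carrier j
    ; _≈_     = λ a b → (λ j → A._≈_ j (a j) (b j)) ∈ 𝓤
    ; _∙_     = λ a b j → A._∙_ j (a j) (b j)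
    ; k       = λ j → A.k j
    ; s       = λ j → A.s j
    ; isMagma = record
      { isEquivalence = record
        { refl  = whole λ {j} _ → A.refl j
        ; sym   = upward λ {j} → A.sym j
        ; trans = λ p q → upward (λ {j} (x , y) → A.trans j x y) (meet p q)
        }
      ; ∙-cong = λ p q → upward (λ {j} (x , y) → A.∙-cong j x y) (meet p q)
      }
    ; k-law = λ x y → whole λ {j} _ → A.k-law j (x j) (y j)
    ; s-law = λ x y z → whole λ {j} _ → A.s-law j (x j) (y j) (z j)
    }

FiniteIntersectionProperty : ∀ {ℓ p} → Pred (LambdaModel ℓ) p → Set (lsuc ℓ ⊔ p)
FiniteIntersectionProperty {ℓ} 𝒞 =
  ∀ (A B : LambdaModel ℓ) → A ∈ 𝒞 → B ∈ 𝒞 →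
  Σ[ C ∈ LambdaModel ℓ ] C ∈ 𝒞 × Eq C ⊆ Eq A ∩ Eq B

UltraproductProperty : ∀ {ℓ p} → Pred (LambdaModel ℓ) p → Set (lsuc ℓ ⊔ p)
UltraproductProperty {ℓ} 𝒞 =
  ∀ (I : Set ℓ) → I → (A : I → LambdaModel ℓ) → (∀ j → A j ∈ 𝒞) →
  (𝓤 : Pred (Pred I ℓ) ℓ) (isUltra : IsProperUltrafilter 𝓤) →
  Σ[ B ∈ LambdaModel ℓ ]
    B ∈ 𝒞 × Ultraproduct (LambdaModel.algebra ∘ A) 𝓤 isUltra ↪ LambdaModel.algebra B

-- For a finite list of equations, the finite intersection property yields a member of 𝒞
-- refuting every equation of the list that some member of 𝒞 refutes.  Take the ultraproduct
-- of these models over the lists, directed by inclusion, for an ultrafilter all of whose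
-- members are cofinal: an equation that some member of 𝒞 refutes fails in it, hence fails in
-- every model into which the ultraproduct embeds.  The ultrafilter is obtained by Tukey's
-- lemma, which follows from excluded middle by Zermelo's tower argument.
module Submission where

open import Defs
open import Level using (Level; suc; _⊔_; 0ℓ; Lift; lift; lower)
open import Axiom.ExcludedMiddle using (ExcludedMiddle)
open import Axiom.Extensionality.Propositional using (Extensionality; lower-extensionality)
open import Data.Bool.Base using (Bool; true; T; _∨_)
open import Data.Bool.Properties using (T-∨; T-≡; ⇔→≡)
open import Data.List.Base using (List; []; _∷_; _++_)
import Data.List.Membership.Propositional as List
import Data.List.Relation.Binary.Subset.Propositional as List
open import Data.List.Relation.Binary.Subset.Propositional.Properties
  using (⊆-trans; ∷⁺ʳ; xs⊆x∷xs; xs⊆xs++ys; xs⊆ys++xs; All-resp-⊇)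
open import Data.List.Relation.Unary.All as All using (All; []; _∷_)
open import Data.List.Relation.Unary.All.Properties using (++⁺; ++⁻)
open import Data.List.Relation.Unary.Any using (here; there)
open import Data.Product.Base using (_×_; Σ-syntax; ∃; _,_; proj₁; proj₂)
open import Data.Sum.Base using (_⊎_; inj₁; inj₂; [_,_]′)
open import Function.Base using (_∘_; id)
open import Function.Bundles using (Equivalence; mk⇔)
open import Relation.Binary.Core using (Rel)
open import Relation.Binary.Definitions using (Transitive)
open import Relation.Binary.PropositionalEquality using (_≡_; refl; cong₂)
  renaming (subst to ≡-subst)
open import Relation.Nullary using (¬_; Dec; yes; no; contradiction)
open import Relation.Nullary.Decidable
  using (⌊_⌋; toWitness; fromWitness; map′; decidable-stable)
open import Relation.Unary using (Pred; _∈_; _⊆_; Satisfiable; ∁)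

-- Boolean-valued subsets and Zermelo's tower of an inflationary step

lower-excludedMiddle : ∀ {a} b → ExcludedMiddle (a ⊔ b) → ExcludedMiddle a
lower-excludedMiddle b em = map′ lower lift (em {Lift b _})

-- Boolean-valued subsets keep the tower in the universe of X, and by function extensionality
-- make the choice of an element to adjoin depend on the extension of a subset only.
Subset : ∀ {a} → Set a → Set a
Subset X = X → Bool

infix 4 _⊑_

_⊑_ : ∀ {a} {X : Set a} → Rel (Subset X) a
G ⊑ H = ∀ {x} → T (G x) → T (H x)

module Tower {a} (em : ExcludedMiddle a) (funext : Extensionality a 0ℓ) {X : Set a}
             (step : Subset X → Subset X) (inflationary : ∀ G → G ⊑ step G) where

  ⋃ : Subset (Subset X) → Subset X
  ⋃ F x = ⌊ em {∃ λ G → T (F G) × T (G x)} ⌋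

  ⊑-⋃ : ∀ {F G} → T (F G) → G ⊑ ⋃ F
  ⊑-⋃ G∈F x∈G = fromWitness (_ , G∈F , x∈G)

  ⊑-antisym : ∀ {G H : Subset X} → G ⊑ H → H ⊑ G → G ≡ H
  ⊑-antisym {G} {H} p q = funext λ x →
    ⇔→≡ (mk⇔ (to ∘ p {x} ∘ from) (to ∘ q {x} ∘ from))
    where
    to : ∀ {b} → T b → b ≡ true
    to = Equivalence.to T-≡
    from : ∀ {b} → b ≡ true → T b
    from = Equivalence.from T-≡

  -- The tower starts at the empty subset, which is the union of the empty family.
  data InTower : Subset X → Set a where
    next  : ∀ {G} → InTower G → InTower (step G)
    union : ∀ F → (∀ {G} → T (F G) → InTower G) → InTower (⋃ F)

  -- The extreme elements of the Bourbaki-Witt argument, with strictness of `G` below `C` replaced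
  -- by the alternative `C ⊑ G`.
  Extreme : Subset X → Set a
  Extreme C = ∀ {G} → InTower G → G ⊑ C → step G ⊑ C ⊎ C ⊑ G

  -- `step` need not be monotone; mutually included subsets are equal by extensionality, hence have
  -- the same step.
  step-cong : ∀ {G H : Subset X} → G ⊑ H → H ⊑ G → step G ⊑ step H
  step-cong p q {x} = ≡-subst (λ K → T (step K x)) (⊑-antisym p q)

  -- Induction on `G`: a step from below an extreme `C` either stays below `C`, or starts at `C`
  -- itself and so reaches `step C`.
  compare : ∀ {C G} → Extreme C → InTower G → G ⊑ C ⊎ step C ⊑ G
  compare e (next {G} tG) with compare e tG
  ... | inj₂ C⁺⊑G = inj₂ (inflationary G ∘ C⁺⊑G)
  ... | inj₁ G⊑C with e tG G⊑C
  ...   | inj₁ G⁺⊑C = inj₁ G⁺⊑C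
  ...   | inj₂ C⊑G  = inj₂ (step-cong C⊑G G⊑C)
  compare {C} e (union F t) with em {∃ λ G → T (F G) × step C ⊑ G}
  ... | yes (_ , G∈F , C⁺⊑G) = inj₂ (⊑-⋃ {F} G∈F ∘ C⁺⊑G)
  ... | no  none = inj₁ λ x∈⋃ → let (G , G∈F , x∈G) = toWitness x∈⋃ in
    [ (λ G⊑C → G⊑C x∈G) , (λ C⁺⊑G → contradiction (G , G∈F , λ {x} → C⁺⊑G {x}) none) ]′
      (compare e (t G∈F))

  -- Induction on `C`. In the union case, either every `D` of the family lies in `G`, or some `D`
  -- does not, and comparing `G` with that extreme `D` leaves only `step G ⊑ D`.
  extreme : ∀ {C} → InTower C → Extreme C
  extreme (next {C} tC) tG G⊑C⁺ with compare (extreme tC) tG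
  ... | inj₂ C⁺⊑G = inj₂ C⁺⊑G
  ... | inj₁ G⊑C with extreme tC tG G⊑C
  ...   | inj₁ G⁺⊑C = inj₁ (inflationary C ∘ G⁺⊑C)
  ...   | inj₂ C⊑G  = inj₁ (step-cong G⊑C C⊑G)
  extreme (union F t) {G} tG G⊑⋃ with em {∃ λ D → T (F D) × ¬ (D ⊑ G)}
  ... | no none = inj₂ λ x∈⋃ → let (D , D∈F , x∈D) = toWitness x∈⋃ in
    decidable-stable em (λ D⋢G → none (D , D∈F , D⋢G)) x∈D
  ... | yes (D , D∈F , D⋢G) with compare (extreme (t D∈F)) tG
  ...   | inj₂ D⁺⊑G = contradiction (λ {x} → D⁺⊑G {x} ∘ inflationary D) D⋢G
  ...   | inj₁ G⊑D with extreme (t D∈F) tG G⊑D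
  ...     | inj₁ G⁺⊑D = inj₁ (⊑-⋃ {F} D∈F ∘ G⁺⊑D)
  ...     | inj₂ D⊑G  = contradiction (λ {x} → D⊑G {x}) D⋢G

  total : ∀ {G H} → InTower G → InTower H → G ⊑ H ⊎ H ⊑ G
  total {G} {H} tG tH with compare (extreme tH) tG
  ... | inj₁ G⊑H  = inj₁ G⊑H
  ... | inj₂ H⁺⊑G = inj₂ (H⁺⊑G ∘ inflationary H)

  top : Subset X
  top = ⋃ λ G → ⌊ em {InTower G} ⌋

  top∈tower : InTower top
  top∈tower = union _ toWitness

  step-top⊑top : step top ⊑ top
  step-top⊑top = ⊑-⋃ (fromWitness (next top∈tower))

-- Tukey's lemma for properties of finite character

module Tukey {a} (em : ExcludedMiddle a) (funext : Extensionality a 0ℓ) {X : Set a}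
             (Con : Pred (List X) a) (con-[] : Con [])
             (con-⊆ : ∀ {xs ys} → xs List.⊆ ys → Con ys → Con xs) where

  Compatible : Subset X → Pred X a
  Compatible G x = ∀ xs → All (T ∘ G) xs → Con (x ∷ xs)

  Consistent : Pred (Subset X) a
  Consistent G = ∀ xs → All (T ∘ G) xs → Con xs

  Extension : Pred (Subset X) a
  Extension G = ∃ λ x → ¬ T (G x) × Compatible G x

  adjoin : Subset X → X → Subset X
  adjoin G x y = G y ∨ ⌊ em {y ≡ x} ⌋

  ∈-adjoin : ∀ G x → T (adjoin G x x)
  ∈-adjoin G x = Equivalence.from (T-∨ {G x}) (inj₂ (fromWitness refl))

  -- The decision is a separate argument so that proofs can match on it; its witness, supplied by
  -- excluded middle, plays the part of a choice function.
  step′ : ∀ G → Dec (Extension G) → Subset X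
  step′ G (yes (x , _)) = adjoin G x
  step′ G (no _)        = G

  step : Subset X → Subset X
  step G = step′ G em

  adjoin-inflationary : ∀ G x → G ⊑ adjoin G x
  adjoin-inflationary G x = Equivalence.from T-∨ ∘ inj₁

  inflationary′ : ∀ G d → G ⊑ step′ G d
  inflationary′ G (yes (x , _)) = adjoin-inflationary G x
  inflationary′ G (no _)        = id

  open Tower em funext step (λ G → inflationary′ G em)

  -- Entries contributed by `adjoin` alone are all `x` and collapse into one head, the form that
  -- `Compatible` speaks of.
  split-adjoin : ∀ G x ys → All (T ∘ adjoin G x) ys →
                 ∃ λ xs → All (T ∘ G) xs × ys List.⊆ (x ∷ xs)
  split-adjoin G x [] [] = [] , [] , λ ()
  split-adjoin G x (y ∷ ys) (y∈ ∷ ys∈) with split-adjoin G x ys ys∈ | Equivalence.to T-∨ y∈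
  ... | xs , xs∈G , sub | inj₁ y∈G =
    y ∷ xs , y∈G ∷ xs∈G ,
    λ { (here eq) → there (here eq) ; (there p) → ∷⁺ʳ x (xs⊆x∷xs xs y) (sub p) }
  ... | xs , xs∈G , sub | inj₂ y≡x =
    xs , xs∈G , λ { (here refl) → here (toWitness y≡x) ; (there p) → sub p }

  step′-consistent : ∀ {G} d → Consistent G → Consistent (step′ G d)
  step′-consistent {G} (yes (x , _ , compatible)) _ ys ys∈ =
    let (xs , xs∈G , sub) = split-adjoin G x ys ys∈ in con-⊆ sub (compatible xs xs∈G)
  step′-consistent (no _) con = con

  -- The tower is a chain, so the largest of finitely many members holding the entries holds them
  -- all; the list is nonempty because `F` may be empty.
  union-finite : ∀ F → (∀ {G} → T (F G) → InTower G) → ∀ x xs → All (T ∘ ⋃ F) (x ∷ xs) →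
                 ∃ λ G → T (F G) × All (T ∘ G) (x ∷ xs)
  union-finite F t x [] (x∈ ∷ []) =
    let (G , G∈F , x∈G) = toWitness x∈ in G , G∈F , x∈G ∷ []
  union-finite F t x (y ∷ ys) (x∈ ∷ ys∈) with toWitness x∈ | union-finite F t y ys ys∈
  ... | G , G∈F , x∈G | H , H∈F , ys∈H with total (t G∈F) (t H∈F)
  ...   | inj₁ G⊑H = H , H∈F , G⊑H x∈G ∷ ys∈H
  ...   | inj₂ H⊑G = G , G∈F , x∈G ∷ All.map H⊑G ys∈H

  tower-consistent : ∀ {G} → InTower G → Consistent G
  tower-consistent (next tG)   = step′-consistent em (tower-consistent tG)
  tower-consistent (union F t) [] _ = con-[]
  tower-consistent (union F t) (x ∷ xs) xs∈ =
    let (G , G∈F , xs∈G) = union-finite F t x xs xs∈ in tower-consistent (t G∈F) (x ∷ xs) xs∈G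

  closed′ : ∀ {G} d → step′ G d ⊑ G → ∀ {x} → Compatible G x → T (G x)
  closed′ {G} (yes (y , y∉G , _)) G⁺⊑G _ = contradiction (G⁺⊑G (∈-adjoin G y)) y∉G
  closed′ (no none) _ {x} compatible =
    decidable-stable (map′ lower lift (em {Lift a _})) λ x∉G → none (x , x∉G , compatible)

  tukey : ∃ λ G → Consistent G × (∀ {x} → Compatible G x → T (G x))
  tukey = top , tower-consistent top∈tower , closed′ em step-top⊑top

-- Ultrafilters of cofinal sets

Cofinal : ∀ {ℓ} {I : Set ℓ} → Rel I ℓ → Pred (Pred I ℓ) ℓ
Cofinal _≤_ S = ∀ i → ∃ λ j → i ≤ j × S j

module _ {ℓ} (em : ExcludedMiddle ℓ) (funext : Extensionality ℓ 0ℓ) {I : Set ℓ}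
         (_≤_ : Rel I ℓ) (≤-trans : Transitive _≤_) (i₀ : I)
         (directed : ∀ i j → ∃ λ h → i ≤ h × j ≤ h) where

  -- Having only cofinal finite intersections is a property of finite character; maximality of a
  -- family with it supplies the closure properties of an ultrafilter.
  cofinal-ultrafilter :
    ∃ λ (𝓤 : Pred (Pred I ℓ) ℓ) → IsProperUltrafilter 𝓤 × 𝓤 ⊆ Cofinal _≤_
  cofinal-ultrafilter = 𝓤 , isUltra , members-cofinal
    where
    Common : List (Subset I) → Pred I ℓ
    Common Ss i = All (λ S → T (S i)) Ss

    Con : Pred (List (Subset I)) ℓ
    Con Ss = Cofinal _≤_ (Common Ss)

    con-map : ∀ {Ss Ts} → Common Ss ⊆ Common Ts → Con Ss → Con Ts
    con-map f con i = let (j , i≤j , p) = con i in j , i≤j , f p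

    con-[] : Con []
    con-[] i = let (j , i≤j , _) = directed i i in j , i≤j , []

    con-⊆ : ∀ {Ss Ts} → Ss List.⊆ Ts → Con Ts → Con Ss
    con-⊆ sub = con-map (All-resp-⊇ sub)

    open Tukey em funext Con con-[] con-⊆

    χ : Pred I ℓ → Subset I
    χ S i = ⌊ em {S i} ⌋

    G : Subset (Subset I)
    G = proj₁ tukey

    consistent : Consistent G
    consistent = proj₁ (proj₂ tukey)

    closed : ∀ {S} → Compatible G S → T (G S)
    closed = proj₂ (proj₂ tukey)

    𝓤 : Pred (Pred I ℓ) ℓ
    𝓤 S = Lift ℓ (T (G (χ S)))

    member : ∀ {S} → Compatible G (χ S) → S ∈ 𝓤
    member compatible = lift (closed compatible)

    members-cofinal : 𝓤 ⊆ Cofinal _≤_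
    members-cofinal (lift S∈G) i with consistent _ (S∈G ∷ []) i
    ... | j , i≤j , Sj ∷ [] = j , i≤j , toWitness Sj

    ultra : ∀ S → S ∈ 𝓤 ⊎ ∁ S ∈ 𝓤
    ultra S with em {∃ λ Ss → All (T ∘ G) Ss × ¬ Con (χ S ∷ Ss)}
    ... | no none = inj₁ (member λ Ss Ss∈G →
      decidable-stable em λ ¬con → none (Ss , Ss∈G , ¬con))
    -- `S` meets `Ss` in a set that is not cofinal. If no index above `i` were in `Ts` and outside
    -- `S`, then above any `h` a common bound `m` and cofinality of `Ss ++ Ts` would give an index
    -- in both `S` and `Ss`.
    ... | yes (Ss , Ss∈G , ¬con) = inj₂ (member λ Ts Ts∈G i →
      decidable-stable em λ none → ¬con λ h →
        let (m , i≤m , h≤m) = directed i h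
            (j , m≤j , p)   = consistent (Ss ++ Ts) (++⁺ Ss∈G Ts∈G) m
            (Ssj , Tsj)     = ++⁻ Ss p
        in j , ≤-trans h≤m m≤j ,
           fromWitness (decidable-stable em λ ¬Sj →
             none (j , ≤-trans i≤m m≤j , fromWitness ¬Sj ∷ Tsj)) ∷ Ssj)

    isUltra : IsProperUltrafilter 𝓤
    isUltra = record
      { upward = λ S⊆T (lift S∈G) → member λ Ss Ss∈G →
          con-map (λ { (Sj ∷ p) → fromWitness (S⊆T (toWitness Sj)) ∷ p })
                  (consistent _ (S∈G ∷ Ss∈G))
      ; whole  = λ U⊆S → member λ Ss Ss∈G →
          con-map (fromWitness (U⊆S _) ∷_) (consistent Ss Ss∈G)
      ; meet   = λ (lift S∈G) (lift T∈G) → member λ Ss Ss∈G →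
          con-map (λ { (Sj ∷ Tj ∷ p) → fromWitness (toWitness Sj , toWitness Tj) ∷ p })
                  (consistent _ (S∈G ∷ T∈G ∷ Ss∈G))
      ; proper = λ S⊆∅ S∈𝓤 → S⊆∅ (proj₂ (proj₂ (members-cofinal S∈𝓤 i₀)))
      ; ultra  = ultra
      }

-- Closed equations in ultraproducts and along embeddings

embedding-value : ∀ {ℓ} {A B : CombinatoryAlgebra ℓ} ((f , _) : A ↪ B) (P : CL 0) →
  CombinatoryAlgebra._≈_ B (f (CombinatoryAlgebra.value A P)) (CombinatoryAlgebra.value B P)
embedding-value (f , emb) 𝐤 = IsEmbedding.k-homo emb
embedding-value (f , emb) 𝐬 = IsEmbedding.s-homo emb
embedding-value {B = B} e@(f , emb) (P · Q) =
  B.trans (IsEmbedding.homo emb _ _) (B.∙-cong (embedding-value e P) (embedding-value e Q))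
  where module B = CombinatoryAlgebra B

ultraproduct-value : ∀ {ℓ} {I : Set ℓ} (A : I → CombinatoryAlgebra ℓ)
  (𝓤 : Pred (Pred I ℓ) ℓ) (isUltra : IsProperUltrafilter 𝓤) (P : CL 0) (j : I) →
  CombinatoryAlgebra.value (Ultraproduct A 𝓤 isUltra) P j ≡ CombinatoryAlgebra.value (A j) P
ultraproduct-value A 𝓤 isUltra 𝐤 j = refl
ultraproduct-value A 𝓤 isUltra 𝐬 j = refl
ultraproduct-value A 𝓤 isUltra (P · Q) j =
  cong₂ (CombinatoryAlgebra._∙_ (A j))
    (ultraproduct-value A 𝓤 isUltra P j) (ultraproduct-value A 𝓤 isUltra Q j)

-- Injectivity reflects the equation into the ultraproduct, where equality is agreement on a member
-- of `𝓤`: one direction of Łoś's theorem for closed equations.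
ultraproduct-Eq : ∀ {ℓ} {I : Set ℓ} (A : I → LambdaModel ℓ)
  (𝓤 : Pred (Pred I ℓ) ℓ) (isUltra : IsProperUltrafilter 𝓤) (B : LambdaModel ℓ) →
  Ultraproduct (LambdaModel.algebra ∘ A) 𝓤 isUltra ↪ LambdaModel.algebra B →
  ∀ {e} → e ∈ Eq B → (λ j → e ∈ Eq (A j)) ∈ 𝓤
ultraproduct-Eq A 𝓤 isUltra B e@(f , emb) {M , N} M≈N =
  IsProperUltrafilter.upward isUltra
    (λ {j} → ≡-subst id (cong₂ (LambdaModel._≈_ (A j)) (value-at (toCL M) j) (value-at (toCL N) j)))
    (IsEmbedding.injective emb
      (B.trans (embedding-value e (toCL M)) (B.trans M≈N (B.sym (embedding-value e (toCL N))))))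
  where
  module B = LambdaModel B
  value-at = ultraproduct-value (LambdaModel.algebra ∘ A) 𝓤 isUltra

-- Refuting models and the minimal model

module Refutation {ℓ p} (em : ExcludedMiddle (suc ℓ ⊔ p)) (𝒞 : Pred (LambdaModel ℓ) p)
                  (fip : FiniteIntersectionProperty 𝒞) (inhabited : Satisfiable 𝒞) where

  Refutable : Pred (Λ⁰ × Λ⁰) (suc ℓ ⊔ p)
  Refutable e = Σ[ B ∈ LambdaModel ℓ ] B ∈ 𝒞 × ¬ e ∈ Eq B

  -- The model for the tail is kept when the head is irrefutable; otherwise `fip` combines it with a
  -- model refuting the head, and a smaller theory refutes more.
  refute : ∀ es → Σ[ A ∈ LambdaModel ℓ ] A ∈ 𝒞 ×
           (∀ e → e List.∈ es → Refutable e → ¬ e ∈ Eq A)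
  refute [] = proj₁ inhabited , proj₂ inhabited , λ _ ()
  refute (e ∷ es) with refute es | em {Refutable e}
  ... | A , A∈𝒞 , refutes | no irrefutable =
    A , A∈𝒞 , λ { _ (here refl) r → contradiction r irrefutable ; e′ (there q) → refutes e′ q }
  ... | A , A∈𝒞 , refutes | yes (B , B∈𝒞 , e∉B) =
    let (C , C∈𝒞 , C⊆) = fip A B A∈𝒞 B∈𝒞 in
    C , C∈𝒞 , λ { _ (here refl) _ e∈C → e∉B (proj₂ (C⊆ {e} e∈C))
                ; e′ (there q) r e∈C → refutes e′ q r (proj₁ (C⊆ {e′} e∈C)) }

  A : Lift ℓ (List (Λ⁰ × Λ⁰)) → LambdaModel ℓ
  A (lift es) = proj₁ (refute es)

  A∈𝒞 : ∀ j → A j ∈ 𝒞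
  A∈𝒞 (lift es) = proj₁ (proj₂ (refute es))

  _≤_ : Rel (Lift ℓ (List (Λ⁰ × Λ⁰))) ℓ
  lift es ≤ lift es′ = Lift ℓ (es List.⊆ es′)

  ≤-trans : Transitive _≤_
  ≤-trans (lift es⊆) (lift es′⊆) = lift (⊆-trans es⊆ es′⊆)

  ≤-directed : ∀ i j → ∃ λ h → i ≤ h × j ≤ h
  ≤-directed (lift es) (lift es′) =
    lift (es ++ es′) , lift (xs⊆xs++ys es es′) , lift (xs⊆ys++xs es′ es)

  embedding-minimal : ∀ 𝓤 (isUltra : IsProperUltrafilter 𝓤) → 𝓤 ⊆ Cofinal _≤_ →
    ∀ M → Ultraproduct (LambdaModel.algebra ∘ A) 𝓤 isUltra ↪ LambdaModel.algebra M →
    ∀ B → B ∈ 𝒞 → Eq M ⊆ Eq B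
  embedding-minimal 𝓤 isUltra cofinal M U↪M B B∈𝒞 {e} e∈M =
    decidable-stable (lower-excludedMiddle (suc ℓ ⊔ p) em) λ e∉B →
      -- Cofinality at the singleton list of `e` gives a list containing `e` whose model
      -- nevertheless satisfies `e`.
      let (lift es , lift e∈es , e∈A) =
            cofinal (ultraproduct-Eq A 𝓤 isUltra M U↪M {e} e∈M) (lift (e ∷ []))
      in proj₂ (proj₂ (refute es)) e (e∈es (here refl)) (B , B∈𝒞 , e∉B) e∈A

  minimal-model : UltraproductProperty 𝒞 →
    (∃ λ 𝓤 → IsProperUltrafilter 𝓤 × 𝓤 ⊆ Cofinal _≤_) →
    Σ[ M ∈ LambdaModel ℓ ] M ∈ 𝒞 × (∀ B → B ∈ 𝒞 → Eq M ⊆ Eq B)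
  minimal-model up (𝓤 , isUltra , cofinal) =
    let (M , M∈𝒞 , U↪M) = up _ (lift []) A A∈𝒞 𝓤 isUltra
    in M , M∈𝒞 , embedding-minimal 𝓤 isUltra cofinal M U↪M

theorem3p1 : ∀ {ℓ p : Level} → ExcludedMiddle (suc ℓ ⊔ p) → Extensionality ℓ ℓ →
    (𝒞 : Pred (LambdaModel ℓ) p) → Satisfiable 𝒞 →
    FiniteIntersectionProperty 𝒞 → UltraproductProperty 𝒞 →
    Σ[ A ∈ LambdaModel ℓ ] A ∈ 𝒞 × (∀ (B : LambdaModel ℓ) → B ∈ 𝒞 → Eq A ⊆ Eq B)
theorem3p1 {ℓ} {p} em funext 𝒞 inhabited fip up =
  minimal-model up
    (cofinal-ultrafilter (lower-excludedMiddle (suc ℓ ⊔ p) em)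
      (lower-extensionality ℓ ℓ funext) _≤_ ≤-trans (lift []) ≤-directed)
  where open Refutation em 𝒞 fip inhabited
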